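{- Let $G$ be an $n$-vertex graph obtained from the graph consisting of two vertices joined by three parallel edges by repeatedly (zero or more times) expanding a vertex to a triangle. Then $G$ has exactly $2^{n/2-1}$ circuit double covers.
   Context: Graphs are finite and may have parallel edges. Expanding a vertex $v$ of degree 3 (incident with edges $e_1,e_2,e_3$) to a triangle means replacing $v$ by three pairwise adjacent new vertices $v_1,v_2,v_3$ and making $e_i$ incident with $v_i$ instead of $v$, for $i=1,2,3$. A circuit is a connected 2-regular subgraph (a subgraph isomorphic to $C_k$ for some $k$; two parallel edges form a circuit $C_2$). A circuit double cover of a graph $G$ is a multiset of circuits of $G$ such that every edge of $G$ is contained in exactly two elements of the multiset (counted with multiplicity). -}

module Defs where

open import Data.Fin using (Fin; _≟_)
open import Data.Fin.Subset using (Subset; _∈_; _∩_; ∣_∣; Nonempty)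
open import Data.Fin.Subset.Properties using (_∈?_)
open import Data.List using (List; length; filter)
open import Data.List.Relation.Binary.Permutation.Propositional using (↭-setoid)
open import Data.List.Relation.Unary.All using (All)
open import Data.Nat using (ℕ)
open import Data.Product using (∃; ∃-syntax; _×_; _,_; proj₁; proj₂)
open import Data.Sum using (_⊎_; inj₁; inj₂)
open import Data.Vec using (tabulate)
open import Function.Bundles using (_⇔_; _↔_; Inverse)
open import Function.Definitions using (Injective)
open import Level using (0ℓ)
open import Relation.Binary.Bundles using (Setoid)
import Relation.Binary.Construct.On as On
open import Relation.Binary.Construct.Closure.ReflexiveTransitive using (Star)
open import Relation.Binary.PropositionalEquality using (_≡_; _≢_)
open import Relation.Nullary using (¬_; Dec; does)
open import Relation.Nullary.Decidable using (_⊎-dec_)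

-- Parallel edges are allowed, loops are not.  The order of the two ends of an
-- edge carries no meaning: everything below goes through Incident.
record Graph : Set where
  field
    #V #E    : ℕ
    ends     : Fin #E → Fin #V × Fin #V
    loopless : ∀ e → proj₁ (ends e) ≢ proj₂ (ends e)

  Vertex Edge : Set
  Vertex = Fin #V
  Edge   = Fin #E

  Incident : Vertex → Edge → Set
  Incident v e = v ≡ proj₁ (ends e) ⊎ v ≡ proj₂ (ends e)

  incident? : ∀ v e → Dec (Incident v e)
  incident? v e = (v ≟ proj₁ (ends e)) ⊎-dec (v ≟ proj₂ (ends e))

  δ : Vertex → Subset #E
  δ v = tabulate λ e → does (incident? v e)

open Graph using (#V; #E)

record IsTripleEdge (G : Graph) : Set where
  open Graph G hiding (#V; #E)
  field
    two-vertices : #V G ≡ 2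
    three-edges  : #E G ≡ 3
    joined       : ∀ v e → Incident v e

-- H arises from G by expanding v to a triangle, up to renaming the vertices
-- and edges of H.
record IsExpansion (G : Graph) (v : Graph.Vertex G) (H : Graph) : Set where
  private
    module G = Graph G
    module H = Graph H
  field
    -- v has degree 3, and e 0, e 1, e 2 are the edges incident with it
    e           : Fin 3 → G.Edge
    e-injective : Injective _≡_ _≡_ e
    e-incident  : ∀ d → G.Incident v d ⇔ (∃[ i ] e i ≡ d)

    vertices : ((∃[ w ] w ≢ v) ⊎ Fin 3) ↔ H.Vertex
    edges    : (G.Edge ⊎ Fin 3) ↔ H.Edge

  oldV : (∃[ w ] w ≢ v) → H.Vertex
  oldV w = Inverse.to vertices (inj₁ w)

  corner : Fin 3 → H.Vertex
  corner i = Inverse.to vertices (inj₂ i)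

  oldE : G.Edge → H.Edge
  oldE d = Inverse.to edges (inj₁ d)

  -- side j is the edge of the triangle opposite to corner j
  side : Fin 3 → H.Edge
  side j = Inverse.to edges (inj₂ j)

  field
    oldV-oldE   : ∀ w d → H.Incident (oldV w) (oldE d) ⇔ G.Incident (proj₁ w) d
    corner-oldE : ∀ i d → H.Incident (corner i) (oldE d) ⇔ e i ≡ d
    oldV-side   : ∀ w j → ¬ H.Incident (oldV w) (side j)
    corner-side : ∀ i j → H.Incident (corner i) (side j) ⇔ i ≢ j

data ExpandedTripleEdge : Graph → Set where
  start  : ∀ {G} → IsTripleEdge G → ExpandedTripleEdge G
  expand : ∀ {G H} → ExpandedTripleEdge G → (v : Graph.Vertex G) →
           IsExpansion G v H → ExpandedTripleEdge H

module _ (G : Graph) where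
  open Graph G hiding (#V; #E)

  -- A candidate subgraph; the closure condition is part of IsCircuit, so that
  -- _≡_ on this type compares only the vertex and edge sets.
  record VertexEdgeSets : Set where
    constructor ⟨_,_⟩
    field
      V : Subset (#V G)
      E : Subset (#E G)

  open VertexEdgeSets

  Step : VertexEdgeSets → Vertex → Vertex → Set
  Step C u w = ∃[ d ] d ∈ E C × Incident u d × Incident w d

  record IsCircuit (C : VertexEdgeSets) : Set where
    field
      subgraph  : ∀ {v d} → d ∈ E C → Incident v d → v ∈ V C
      nonempty  : Nonempty (V C)
      connected : ∀ {u w} → u ∈ V C → w ∈ V C → Star (Step C) u w
      2-regular : ∀ {v} → v ∈ V C → ∣ E C ∩ δ v ∣ ≡ 2

  record CircuitDoubleCover : Set where
    field
      members  : List VertexEdgeSets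
      circuits : All IsCircuit members
      covers   : ∀ d → length (filter (λ C → d ∈? E C) members) ≡ 2

  -- Double covers are multisets: lists up to permutation.
  circuitDoubleCovers : Setoid 0ℓ 0ℓ
  circuitDoubleCovers =
    On.setoid (↭-setoid {A = VertexEdgeSets}) CircuitDoubleCover.members

{-# OPTIONS --safe #-}

-- Let H arise from G by expanding v to a triangle.  A circuit C of H other than
-- the triangle is determined by the circuit of G obtained by contracting the
-- triangle, together with the sides it uses: one side or two if C passes through
-- the triangle.  In a circuit double cover every two edges at a cubic vertex are
-- consecutive on exactly one circuit.  Applied to the corners, this shows that a
-- double cover of H either contains the triangle, and its other circuits use at
-- most one side each, or consists of circuits using zero or two sides each.  So
-- every double cover of G lifts in exactly two ways, and each expansion adds two
-- vertices.
module Submission where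

open import Defs
open import Data.Bool using (Bool; true; false; not; _∧_; _∨_; _xor_)
open import Data.Bool.Properties using (¬-not; ∧-assoc; ∧-comm; ∧-identityʳ)
open import Data.Fin using (Fin; zero; suc; _≟_; combine; punchIn; punchOut; remQuot)
open import Data.Fin.Patterns using (0F; 1F; 2F)
open import Data.Fin.Permutation using (↔⇒≡)
open import Data.Fin.Properties
  using (¬Fin0; suc-injective; combine-remQuot; remQuot-combine; punchInᵢ≢i;
         punchIn-punchOut; punchOut-punchIn; punchOut-cong; +↔⊎)
open import Data.Fin.Subset using (Subset; _∩_; ∣_∣; ⊥)
open import Data.Fin.Subset.Properties using (_∈?_; Empty-unique; ∣⊥∣≡0)
open import Data.List using (List; []; _∷_; filter; length; map)
open import Data.List.Properties using (map-∘; map-id-local)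
open import Data.List.Relation.Binary.Permutation.Propositional
  using (_↭_; ↭-refl; ↭-reflexive; ↭-sym; ↭-trans; prep; swap)
open import Data.List.Relation.Binary.Permutation.Propositional.Properties
  using (All-resp-↭; drop-∷; map⁺)
open import Data.List.Relation.Unary.All as All using (All; []; _∷_)
import Data.List.Relation.Unary.All.Properties as All
open import Data.Nat using (ℕ; zero; suc; _+_; _*_; _^_; _/_; _∸_)
open import Data.Nat.DivMod using (m*n/n≡m)
open import Data.Nat.ListAction using (sum)
open import Data.Nat.ListAction.Properties using (sum-↭)
open import Data.Nat.Properties as ℕ
  using (+-cancelʳ-≡; +-comm; +-commutativeSemigroup; m+n≡0⇒m≡0; m+n≡0⇒n≡0)
open import Data.Product using (∃₂; ∃-syntax; _×_; _,_; proj₁; proj₂)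
open import Data.Sum using (_⊎_; inj₁; inj₂; [_,_]′)
open import Data.Sum.Function.Propositional using (_⊎-↔_)
open import Data.Sum.Properties using (inj₁-injective; inj₂-injective)
open import Data.Vec using (_∷_; []; lookup; replicate; tabulate; _[_]≔_)
open import Data.Vec.Properties
  using ([]=⇒lookup; lookup⇒[]=; lookup∘tabulate; lookup∘update; lookup∘update′;
         lookup-replicate; lookup-zipWith; tabulate∘lookup; tabulate-cong)
open import Function using (_∘_; const; id)
open import Function.Bundles using (_⇔_; _↔_; Bijection; Equivalence; Inverse; mk⇔; mk↔ₛ′)
open import Function.Construct.Composition using (_↔-∘_)
open import Function.Construct.Identity using (↔-id)
open import Function.Definitions using (Injective)
open import Level using (0ℓ)
open import Relation.Binary.Construct.Closure.ReflexiveTransitive using (Star; ε; _◅_; _◅◅_)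
open import Relation.Binary.PropositionalEquality
open import Relation.Nullary using (¬_; Dec; does; yes; no; contradiction)
open import Relation.Nullary.Decidable using (dec-true; does-⇔)
open import Relation.Unary using (Pred; Decidable)
open import Algebra.Properties.CommutativeSemigroup +-commutativeSemigroup using (interchange)

-- Over the field with two elements, the sides `σ` and the outer edges `x` of an even subgraph
-- satisfy `x i = σ (i+1) + σ (i+2)`, a linear system whose kernel is spanned by the all-ones
-- vector. An even `x` therefore has two solutions, complementary to each other; for `x = 0` one of
-- them is the triangle itself. Each circuit through the centre could choose its solution
-- independently, but the number of members with a given transition ties the choices together.
-- Parity forces that number: if `a = b xor c` on every member, the counts satisfy `2 + 2 = 2 + 2t`,
-- hence `t = 1`. Connectedness is kept apart from these local conditions; it survives a lift
-- because the visited part of each fibre of the contraction is connected. The induction starts at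
-- the triple edge, where each of the three pairs of edges lies on exactly one member, so that the
-- cover consists of the three digons.

private variable
  A B : Set
  m n : ℕ

-- Counting the members of a list with a Boolean property

true≢false : true ≢ false
true≢false ()

bit : Bool → ℕ
bit false = 0
bit true  = 1

bit≡0 : ∀ {a} → bit a ≡ 0 → a ≡ false
bit≡0 {false} _ = refl

bit-xor-∧ : ∀ b c → bit b + bit c ≡ bit (b xor c) + (bit (b ∧ c) + bit (b ∧ c))
bit-xor-∧ false false = refl
bit-xor-∧ false true  = refl
bit-xor-∧ true  false = refl
bit-xor-∧ true  true  = refl

total : (A → ℕ) → List A → ℕ
total f xs = sum (map f xs)

count : (A → Bool) → List A → ℕ
count f = total (bit ∘ f)

total-cong : ∀ {f g : A → ℕ} {xs} → All (λ x → f x ≡ g x) xs → total f xs ≡ total g xs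
total-cong []       = refl
total-cong (p ∷ ps) = cong₂ _+_ p (total-cong ps)

total-+ : ∀ (f g : A → ℕ) xs → total (λ x → f x + g x) xs ≡ total f xs + total g xs
total-+ f g []       = refl
total-+ f g (x ∷ xs) = trans (cong (f x + g x +_) (total-+ f g xs))
                             (interchange (f x) (g x) (total f xs) (total g xs))

total-↭ : ∀ (f : A → ℕ) {xs ys} → xs ↭ ys → total f xs ≡ total f ys
total-↭ f p = sum-↭ (map⁺ f p)

total-map : ∀ (f : B → ℕ) (g : A → B) xs → total f (map g xs) ≡ total (f ∘ g) xs
total-map f g xs = cong sum (sym (map-∘ xs))

count-cong : ∀ {f g : A → Bool} {xs} → All (λ x → f x ≡ g x) xs → count f xs ≡ count g xs
count-cong = total-cong ∘ All.map (cong bit)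

count≡0 : ∀ {f : A → Bool} xs → count f xs ≡ 0 → All (λ x → f x ≡ false) xs
count≡0         []       _  = []
count≡0 {f = f} (x ∷ xs) eq =
  bit≡0 (m+n≡0⇒m≡0 (bit (f x)) eq) ∷ count≡0 xs (m+n≡0⇒n≡0 (bit (f x)) eq)

extract : ∀ (f : A → Bool) xs {k} → count f xs ≡ suc k →
          ∃₂ λ x ys → xs ↭ x ∷ ys × f x ≡ true
extract f (x ∷ xs) eq with f x in fx
... | true  = x , xs , ↭-refl , fx
... | false with y , ys , p , fy ← extract f xs eq =
  y , x ∷ ys , ↭-trans (prep x p) (swap x y ↭-refl) , fy

count-filter : ∀ {P : Pred A 0ℓ} (P? : Decidable P) xs →
               length (filter P? xs) ≡ count (does ∘ P?) xs
count-filter P? []       = refl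
count-filter P? (x ∷ xs) with does (P? x)
... | true  = cong suc (count-filter P? xs)
... | false = count-filter P? xs

-- Applied to the three edges a, b, c at a vertex and the circuits of a double cover.
count-transition : ∀ {a b c : A → Bool} {xs} → All (λ x → a x ≡ b x xor c x) xs →
                   count a xs ≡ 2 → count b xs ≡ 2 → count c xs ≡ 2 →
                   count (λ x → b x ∧ c x) xs ≡ 1
count-transition {a = a} {b} {c} {xs} a≡b⊕c a≡2 b≡2 c≡2 = half (begin
  2 + (t + t)                     ≡⟨ cong (_+ (t + t)) (sym a≡2) ⟩
  count a xs + (t + t)            ≡⟨ cong (count a xs +_) (sym (total-+ β β xs)) ⟩
  count a xs + total (λ x → β x + β x) xs
                                  ≡⟨ sym (total-+ (bit ∘ a) (λ x → β x + β x) xs) ⟩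
  total (λ x → bit (a x) + (β x + β x)) xs
                                  ≡⟨ sym (total-cong (All.map (λ {x} → pointwise x) a≡b⊕c)) ⟩
  total (λ x → bit (b x) + bit (c x)) xs
                                  ≡⟨ total-+ (bit ∘ b) (bit ∘ c) xs ⟩
  count b xs + count c xs         ≡⟨ cong₂ _+_ b≡2 c≡2 ⟩
  4                               ∎)
  where
  open ≡-Reasoning
  β = λ x → bit (b x ∧ c x)
  t = total β xs
  pointwise : ∀ x → a x ≡ b x xor c x → bit (b x) + bit (c x) ≡ bit (a x) + (β x + β x)
  pointwise x eq rewrite eq = bit-xor-∧ (b x) (c x)
  half : ∀ {t} → 2 + (t + t) ≡ 4 → t ≡ 1
  half {1} _ = refl
  half {suc (suc t)} eq rewrite +-comm t (suc (suc t)) with () ← eq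

-- Subsets and their sizes

lookup-ext : (p q : Subset n) → (∀ i → lookup p i ≡ lookup q i) → p ≡ q
lookup-ext p q eq =
  trans (sym (tabulate∘lookup p)) (trans (tabulate-cong eq) (tabulate∘lookup q))

does-∈? : ∀ (x : Fin n) p → does (x ∈? p) ≡ lookup p x
does-∈? zero    (false ∷ p) = refl
does-∈? zero    (true  ∷ p) = refl
does-∈? (suc x) (_     ∷ p) = does-∈? x p

∣p∣-remove : ∀ (p : Subset n) x → lookup p x ≡ true → ∣ p ∣ ≡ suc ∣ p [ x ]≔ false ∣
∣p∣-remove (true  ∷ p) zero    refl = refl
∣p∣-remove (false ∷ p) (suc x) eq = ∣p∣-remove p x eq
∣p∣-remove (true  ∷ p) (suc x) eq = cong suc (∣p∣-remove p x eq)

-- Degrees are sizes of subsets of the set of all edges; this moves them to an enumeration `f` of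
-- the edges that can occur. In the induction, `f zero` is deleted from `p` if present, after which
-- `f ∘ suc` still reaches every element.
∣p∣-preimage : (f : Fin m → Fin n) → Injective _≡_ _≡_ f → ∀ p →
               (∀ {j} → lookup p j ≡ true → ∃[ i ] f i ≡ j) →
               ∣ p ∣ ≡ ∣ tabulate (lookup p ∘ f) ∣
∣p∣-preimage {zero} {n} f f-inj p onto =
  trans (cong ∣_∣ (Empty-unique {p = p} λ (j , j∈p) → ¬Fin0 (proj₁ (onto ([]=⇒lookup j∈p))))) (∣⊥∣≡0 n)
∣p∣-preimage {suc m} f f-inj p onto with lookup p (f zero) in eq
... | false = ∣p∣-preimage (f ∘ suc) (suc-injective ∘ f-inj) p onto′
  where
  onto′ : ∀ {j} → lookup p j ≡ true → ∃[ i ] f (suc i) ≡ j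
  onto′ j∈p with onto j∈p
  ... | zero  , refl = contradiction (trans (sym j∈p) eq) true≢false
  ... | suc i , fi≡j = i , fi≡j
... | true = begin
  ∣ p ∣                                   ≡⟨ ∣p∣-remove p (f zero) eq ⟩
  suc ∣ q ∣                               ≡⟨ cong suc (∣p∣-preimage (f ∘ suc) (suc-injective ∘ f-inj) q onto′) ⟩
  suc ∣ tabulate (lookup q ∘ f ∘ suc) ∣   ≡⟨ cong (suc ∘ ∣_∣) (tabulate-cong λ i → lookup∘update′ (f0≢ i) p false) ⟩
  suc ∣ tabulate (lookup p ∘ f ∘ suc) ∣   ∎
  where
  open ≡-Reasoning
  q = p [ f zero ]≔ false
  f0≢ : ∀ i → f (suc i) ≢ f zero
  f0≢ i fi≡f0 with () ← f-inj fi≡f0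
  onto′ : ∀ {j} → lookup q j ≡ true → ∃[ i ] f (suc i) ≡ j
  onto′ {j} j∈q with j ≟ f zero
  ... | yes refl = contradiction (trans (sym j∈q) (lookup∘update (f zero) p false)) true≢false
  ... | no j≢f0 with onto (trans (sym (lookup∘update′ j≢f0 p false)) j∈q)
  ...   | zero  , f0≡j = contradiction (sym f0≡j) j≢f0
  ...   | suc i , fi≡j = i , fi≡j

-- Degree two among three edges amounts to even parity and not being empty. Under even parity `a`
-- cannot be the only one true, so `b ∨ c` already expresses the latter.
∣abc∣≡2⇒ : ∀ a b c → ∣ a ∷ b ∷ c ∷ [] ∣ ≡ 2 → a ≡ b xor c × b ∨ c ≡ true
∣abc∣≡2⇒ false true  true  _ = refl , refl
∣abc∣≡2⇒ true  false true  _ = refl , refl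
∣abc∣≡2⇒ true  true  false _ = refl , refl
∣abc∣≡2⇒ false false false ()
∣abc∣≡2⇒ false true  false ()
∣abc∣≡2⇒ false false true  ()
∣abc∣≡2⇒ true  false false ()
∣abc∣≡2⇒ true  true  true  ()

∣abc∣≡2⇐ : ∀ a b c → a ≡ b xor c → b ∨ c ≡ true → ∣ a ∷ b ∷ c ∷ [] ∣ ≡ 2
∣abc∣≡2⇐ false true  true  _ _ = refl
∣abc∣≡2⇐ true  false true  _ _ = refl
∣abc∣≡2⇐ true  true  false _ _ = refl
∣abc∣≡2⇐ false false false _ ()
∣abc∣≡2⇐ true  false false ()
∣abc∣≡2⇐ true  true  true ()
∣abc∣≡2⇐ false false true  ()
∣abc∣≡2⇐ false true false ()

∧-does : ∀ {P : Set} b (P? : Dec P) → b ∧ does P? ≡ true → P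
∧-does true (yes p) _ = p

-- Two-regular subgraphs and cubic vertices

module _ {G : Graph} where
  open Graph G
  open VertexEdgeSets

  lookup-δ : ∀ p v d → lookup (p ∩ δ v) d ≡ lookup p d ∧ does (incident? v d)
  lookup-δ p v d = trans (lookup-zipWith _∧_ d p (δ v))
    (cong (lookup p d ∧_) (lookup∘tabulate (λ d → does (incident? v d)) d))

  lookup-δ⇒Incident : ∀ p v d → lookup (p ∩ δ v) d ≡ true → Incident v d
  lookup-δ⇒Incident p v d eq = ∧-does (lookup p d) (incident? v d) (trans (sym (lookup-δ p v d)) eq)

  -- The local half of `IsCircuit`, phrased with Boolean lookups. The local arguments need only this
  -- much, and it admits the empty subgraph.
  record IsTwoRegular (C : VertexEdgeSets G) : Set where
    field
      subgraph : ∀ {v d} → lookup (E C) d ≡ true → Incident v d → lookup (V C) v ≡ true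
      degree   : ∀ {v} → lookup (V C) v ≡ true → ∣ E C ∩ δ v ∣ ≡ 2

  circuit⇒twoRegular : ∀ {C} → IsCircuit G C → IsTwoRegular C
  circuit⇒twoRegular c = record
    { subgraph = λ d∈ i → []=⇒lookup (IsCircuit.subgraph c (lookup⇒[]= _ _ d∈) i)
    ; degree   = λ v∈ → IsCircuit.2-regular c (lookup⇒[]= _ _ v∈)
    }

  mkCircuit : ∀ {C} → IsTwoRegular C → (∃[ v ] lookup (V C) v ≡ true) →
              (∀ {u w} → lookup (V C) u ≡ true → lookup (V C) w ≡ true → Star (Step G C) u w) →
              IsCircuit G C
  mkCircuit t (v , v∈) conn = record
    { subgraph  = λ d∈ i → lookup⇒[]= _ _ (IsTwoRegular.subgraph t ([]=⇒lookup d∈) i)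
    ; nonempty  = v , lookup⇒[]= _ _ v∈
    ; connected = λ u∈ w∈ → conn ([]=⇒lookup u∈) ([]=⇒lookup w∈)
    ; 2-regular = λ v∈ → IsTwoRegular.degree t ([]=⇒lookup v∈)
    }

  module Cubic (v : Vertex) (f : Fin 3 → Edge) (f-inj : Injective _≡_ _≡_ f)
               (f-inc : ∀ d → Incident v d ⇔ (∃[ i ] f i ≡ d)) where

    degree≡ : ∀ p → ∣ p ∩ δ v ∣ ≡ ∣ tabulate (lookup p ∘ f) ∣
    degree≡ p = trans
      (∣p∣-preimage f f-inj (p ∩ δ v) λ {d} → Equivalence.to (f-inc d) ∘ lookup-δ⇒Incident p v d)
      (cong ∣_∣ (tabulate-cong λ i → trans (lookup-δ p v (f i))
        (trans (cong (lookup p (f i) ∧_) (dec-true (incident? v (f i)) (Equivalence.from (f-inc (f i)) (i , refl))))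
               (∧-identityʳ _))))

    module _ {C} (t : IsTwoRegular C) where
      open IsTwoRegular t

      private
        local : lookup (E C) (f 0F) ≡ lookup (E C) (f 1F) xor lookup (E C) (f 2F) ×
                lookup (E C) (f 1F) ∨ lookup (E C) (f 2F) ≡ lookup (V C) v
        local with lookup (V C) v in v∈?
        ... | true  = ∣abc∣≡2⇒ (lookup (E C) (f 0F)) (lookup (E C) (f 1F)) (lookup (E C) (f 2F))
          (trans (sym (degree≡ (E C))) (degree v∈?))
        -- By `subgraph` an unvisited vertex carries no edge of `C`, so both equations hold with all
        -- bits false. Parity is thus available at every cubic vertex.
        ... | false = none (out 0F) (out 1F) (out 2F)
          where
          out : ∀ i → lookup (E C) (f i) ≡ false
          out i with lookup (E C) (f i) in d∈?
          ... | false = refl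
          ... | true  = contradiction
            (trans (sym (subgraph d∈? (Equivalence.from (f-inc (f i)) (i , refl)))) v∈?) true≢false
          none : ∀ {a b c} → a ≡ false → b ≡ false → c ≡ false → a ≡ b xor c × b ∨ c ≡ false
          none refl refl refl = refl , refl

      parity : lookup (E C) (f 0F) ≡ lookup (E C) (f 1F) xor lookup (E C) (f 2F)
      parity = proj₁ local

      visited : lookup (V C) v ≡ lookup (E C) (f 1F) ∨ lookup (E C) (f 2F)
      visited = sym (proj₂ local)

  count-covers : ∀ (M : List (VertexEdgeSets G)) d →
                 length (filter (λ C → d ∈? E C) M) ≡ count (λ C → lookup (E C) d) M
  count-covers M d = trans (count-filter (λ C → d ∈? E C) M)
    (count-cong (All.universal (λ C → does-∈? d (E C)) M))

-- Local configurations at a triangle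

next : Fin 3 → Fin 3
next 0F = 1F
next 1F = 2F
next 2F = 0F

next≢ : ∀ i → next i ≢ i
next≢ 0F ()
next≢ 1F ()
next≢ 2F ()

next²≢ : ∀ i → next (next i) ≢ i
next²≢ 0F ()
next²≢ 1F ()
next²≢ 2F ()

≢⇒next : ∀ i j → i ≢ j → j ≡ next i ⊎ j ≡ next (next i)
≢⇒next 0F 0F i≢j = contradiction refl i≢j
≢⇒next 0F 1F _ = inj₁ refl
≢⇒next 0F 2F _ = inj₂ refl
≢⇒next 1F 0F _ = inj₂ refl
≢⇒next 1F 1F i≢j = contradiction refl i≢j
≢⇒next 1F 2F _ = inj₁ refl
≢⇒next 2F 0F _ = inj₁ refl
≢⇒next 2F 1F _ = inj₂ refl
≢⇒next 2F 2F i≢j = contradiction refl i≢j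

third : ∀ (i j : Fin 3) → ∃[ k ] k ≢ i × k ≢ j
third 0F 0F = 1F , (λ ()) , (λ ())
third 0F 1F = 2F , (λ ()) , (λ ())
third 0F 2F = 1F , (λ ()) , (λ ())
third 1F 0F = 2F , (λ ()) , (λ ())
third 1F 1F = 2F , (λ ()) , (λ ())
third 1F 2F = 0F , (λ ()) , (λ ())
third 2F 0F = 1F , (λ ()) , (λ ())
third 2F 1F = 0F , (λ ()) , (λ ())
third 2F 2F = 0F , (λ ()) , (λ ())

∨-true : ∀ {a b} → a ∨ b ≡ true → a ≡ true ⊎ b ≡ true
∨-true {true}         _ = inj₁ refl
∨-true {false} {true} _ = inj₂ refl

⊎⇒∨ : ∀ {a b} → a ≡ true ⊎ b ≡ true → a ∨ b ≡ true
⊎⇒∨         (inj₁ refl) = refl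
⊎⇒∨ {false} (inj₂ refl) = refl
⊎⇒∨ {true}  (inj₂ refl) = refl

some : (Fin 3 → Bool) → Bool
some x = x 0F ∨ (x 1F ∨ x 2F)

some⁺ : ∀ (x : Fin 3 → Bool) i → x i ≡ true → some x ≡ true
some⁺ x 0F eq = ⊎⇒∨ (inj₁ eq)
some⁺ x 1F eq = ⊎⇒∨ {x 0F} (inj₂ (⊎⇒∨ (inj₁ eq)))
some⁺ x 2F eq = ⊎⇒∨ {x 0F} (inj₂ (⊎⇒∨ {x 1F} (inj₂ eq)))

some⁻ : ∀ (x : Fin 3 → Bool) → some x ≡ true → ∃[ i ] x i ≡ true
some⁻ x eq with ∨-true {x 0F} eq
... | inj₁ p = 0F , p
... | inj₂ q with ∨-true {x 1F} q
...   | inj₁ p = 1F , p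
...   | inj₂ p = 2F , p

-- The local condition for a subgraph with edges x outside and σ on the
-- triangle to have even degree at every corner.
Fits : (x σ : Fin 3 → Bool) → Set
Fits x σ = ∀ i → x i ≡ σ (next i) xor σ (next (next i))

NotAll : (Fin 3 → Bool) → Set
NotAll σ = ∃[ i ] σ i ≡ false

module _ {x : Fin 3 → Bool} where

  -- Every side has two corners, so each bit of `σ` cancels in the sum over the corners.
  fits⇒even : ∀ {σ} → Fits x σ → x 0F ≡ x 1F xor x 2F
  fits⇒even {σ} fits rewrite fits 0F | fits 1F | fits 2F = bool (σ 0F) (σ 1F) (σ 2F)
    where
    bool : ∀ a b c → b xor c ≡ (c xor a) xor (a xor b)
    bool false false false = refl
    bool false false true  = refl
    bool false true  false = refl
    bool false true  true  = refl
    bool true  false false = refl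
    bool true  false true  = refl
    bool true  true  false = refl
    bool true  true  true  = refl

  fits-exits : ∀ {σ} → Fits x σ → NotAll σ → ∀ j → σ j ≡ true → ∃[ i ] x i ≡ true
  fits-exits {σ} fits (i , σi) j σj
    with k , k≢i , k≢j ← third i j
    with ≢⇒next k i k≢i | ≢⇒next k j k≢j
  ... | inj₁ refl | inj₁ refl = contradiction (trans (sym σj) σi) true≢false
  ... | inj₂ refl | inj₂ refl = contradiction (trans (sym σj) σi) true≢false
  ... | inj₁ refl | inj₂ refl = k , trans (fits k) (cong₂ _xor_ σi σj)
  ... | inj₂ refl | inj₁ refl = k , trans (fits k) (cong₂ _xor_ σj σi)

-- The two solutions of Fits for a circuit through the centre: it traverses one
-- side of the triangle or the other two.
shortcut : (Fin 3 → Bool) → Fin 3 → Bool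
shortcut x i = x (next i) ∧ x (next (next i))

module _ (x : Fin 3 → Bool) (even : x 0F ≡ x 1F xor x 2F) where
  private
    rotate : ∀ a b c → a ≡ b xor c → b ≡ c xor a
    rotate false false false _ = refl
    rotate false true  true  _ = refl
    rotate true  false true  _ = refl
    rotate true  true  false _ = refl

    short : ∀ a b c → a ≡ b xor c → a ≡ (c ∧ a) xor (a ∧ b)
    short false false false _ = refl
    short false true  true  _ = refl
    short true  false true  _ = refl
    short true  true  false _ = refl

    ∨-even : ∀ a b c → a ≡ b xor c → a ∨ (b ∨ c) ≡ b ∨ c
    ∨-even false b     c    _ = refl
    ∨-even true  true  c    _ = refl
    ∨-even true  false true _ = refl

  -- This is the longer route: if `x` holds at two corners, the sides opposite to them form the path
  -- through the third corner.
  fits-self : Fits x x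
  fits-self 0F = even
  fits-self 1F = rotate (x 0F) (x 1F) (x 2F) even
  fits-self 2F = rotate (x 1F) (x 2F) (x 0F) (fits-self 1F)

  fits-shortcut : Fits x (shortcut x)
  fits-shortcut 0F = short (x 0F) (x 1F) (x 2F) (fits-self 0F)
  fits-shortcut 1F = short (x 1F) (x 2F) (x 0F) (fits-self 1F)
  fits-shortcut 2F = short (x 2F) (x 0F) (x 1F) (fits-self 2F)

  notAll-self : NotAll x
  notAll-self with x 1F in x₁ | x 2F in x₂
  ... | false | _     = 1F , x₁
  ... | true  | false = 2F , x₂
  ... | true  | true  = 0F , even

  notAll-shortcut : NotAll (shortcut x)
  notAll-shortcut with notAll-self
  ... | 0F , x₀ = 2F , cong (_∧ x 1F) x₀
  ... | 1F , x₁ = 0F , cong (_∧ x 2F) x₁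
  ... | 2F , x₂ = 1F , cong (_∧ x 0F) x₂

  some-even : some x ≡ x 1F ∨ x 2F
  some-even = ∨-even (x 0F) (x 1F) (x 2F) even

single : (Fin 3 → Bool) → Fin 3 → Bool
single σ i = σ i ∧ not (σ (next i) ∨ σ (next (next i)))

every : (Fin 3 → Bool) → Bool
every σ = σ 0F ∧ (σ 1F ∧ σ 2F)

every⁻ : ∀ σ → every σ ≡ true → ∀ i → σ i ≡ true
every⁻ σ eq with σ 0F in σ₀ | σ 1F in σ₁ | σ 2F in σ₂
... | true | true | true = λ { 0F → σ₀ ; 1F → σ₁ ; 2F → σ₂ }

¬every⇒NotAll : ∀ σ → every σ ≡ false → NotAll σ
¬every⇒NotAll σ eq with σ 0F in σ₀ | σ 1F in σ₁ | σ 2F in σ₂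
... | false | _     | _     = 0F , σ₀
... | true  | false | _     = 1F , σ₁
... | true  | true  | false = 2F , σ₂

module _ {x σ : Fin 3 → Bool} (fits : Fits x σ) where
  private
    solve-short : ∀ a b c → b ∧ c ≡ false → c ∧ a ≡ false → a ∧ b ≡ false → a ≡ (c xor a) ∧ (a xor b)
    solve-short false false false _ _ _ = refl
    solve-short false false true  _ _ _ = refl
    solve-short false true  false _ _ _ = refl
    solve-short true  false false _ _ _ = refl
    solve-short false true  true ()
    solve-short true  false true _ ()
    solve-short true  true  false _ _ ()
    solve-short true  true  true ()

    solve-long : ∀ a b c → a ∧ (b ∧ c) ≡ false →
                 a ∧ not (b ∨ c) ≡ false → b ∧ not (c ∨ a) ≡ false → c ∧ not (a ∨ b) ≡ false →
                 a ≡ b xor c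
    solve-long false false false _ _ _ _ = refl
    solve-long false true  true  _ _ _ _ = refl
    solve-long true  false true  _ _ _ _ = refl
    solve-long true  true  false _ _ _ _ = refl
    solve-long true  true  true  ()
    solve-long true  false false _ ()
    solve-long false true  false _ _ ()
    solve-long false false true  _ _ _ ()

    -- For a variable `i`, `next (next (next i))` does not reduce to `i`. The coincidences are
    -- therefore taken as equations, which become `refl` once `i` is a numeral.
    short : ∀ i {a b c} → σ i ≡ a → σ (next i) ≡ b → σ (next (next i)) ≡ c → σ (next (next (next i))) ≡ a →
            σ (next (next (next (next i)))) ≡ b →
            b ∧ c ≡ false → c ∧ a ≡ false → a ∧ b ≡ false → σ i ≡ shortcut x i
    short i {a} {b} {c} refl refl refl eqa eqb bc ca ab
      rewrite fits (next i) | fits (next (next i)) | eqa | eqb = solve-short a b c bc ca ab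

  -- No two sides are used together, so at most one is. If there is one, the outer edges in use are
  -- exactly those at its two ends.
  only-short : (∀ i → shortcut σ i ≡ false) → ∀ i → σ i ≡ shortcut x i
  only-short p 0F = short 0F refl refl refl refl refl (p 0F) (p 1F) (p 2F)
  only-short p 1F = short 1F refl refl refl refl refl (p 1F) (p 2F) (p 0F)
  only-short p 2F = short 2F refl refl refl refl refl (p 2F) (p 0F) (p 1F)

  -- With three sides and one side excluded, `σ` has zero or two sides. It is then even and solves
  -- its own system, whose right-hand side is `x` by `fits`.
  only-long : every σ ≡ false → (∀ i → single σ i ≡ false) → ∀ i → σ i ≡ x i
  only-long ¬all p i = trans (long i) (sym (fits i))
    where
    σ-even : σ 0F ≡ σ 1F xor σ 2F
    σ-even = solve-long (σ 0F) (σ 1F) (σ 2F) ¬all (p 0F) (p 1F) (p 2F)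
    long : ∀ i → σ i ≡ σ (next i) xor σ (next (next i))
    long = fits-self σ σ-even

∧-rotate : ∀ a b c → a ∧ (b ∧ c) ≡ b ∧ (c ∧ a)
∧-rotate a b c = trans (∧-comm a (b ∧ c)) (∧-assoc b c a)

-- A member with `a` has `a` alone, or also `b`, or also `c`, and never both. The two pair counts
-- already use up the two members with `a`.
count-single : ∀ {A : Set} {a b c : A → Bool} {xs} → All (λ x → a x ∧ (b x ∧ c x) ≡ false) xs →
               count a xs ≡ 2 → count (λ x → a x ∧ b x) xs ≡ 1 → count (λ x → c x ∧ a x) xs ≡ 1 →
               count (λ x → a x ∧ not (b x ∨ c x)) xs ≡ 0
count-single {a = a} {b} {c} {xs} ¬abc a≡2 ab≡1 ca≡1 = +-cancelʳ-≡ 2 _ 0 (begin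
  count α xs + 2                               ≡⟨ cong (count α xs +_) (cong₂ _+_ (sym ab≡1) (sym ca≡1)) ⟩
  count α xs + (count β xs + count γ xs)       ≡⟨ cong (count α xs +_) (sym (total-+ (bit ∘ β) (bit ∘ γ) xs)) ⟩
  count α xs + total (λ x → bit (β x) + bit (γ x)) xs
                                               ≡⟨ sym (total-+ (bit ∘ α) _ xs) ⟩
  total (λ x → bit (α x) + (bit (β x) + bit (γ x))) xs
                                               ≡⟨ total-cong (All.map (λ {x} → pointwise (a x) (b x) (c x)) ¬abc) ⟩
  count a xs                                   ≡⟨ a≡2 ⟩
  2                                            ∎)
  where
  open ≡-Reasoning
  α = λ x → a x ∧ not (b x ∨ c x)
  β = λ x → a x ∧ b x
  γ = λ x → c x ∧ a x
  pointwise : ∀ a b c → a ∧ (b ∧ c) ≡ false →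
              bit (a ∧ not (b ∨ c)) + (bit (a ∧ b) + bit (c ∧ a)) ≡ bit a
  pointwise false b     false _ = refl
  pointwise false b     true  _ = refl
  pointwise true  false false _ = refl
  pointwise true  false true  _ = refl
  pointwise true  true  false _ = refl

-- Lifting and projecting subgraphs along an expansion

module Expansion {G H : Graph} {v : Graph.Vertex G} (X : IsExpansion G v H) where
  open IsExpansion X
  open VertexEdgeSets
  private
    module G = Graph G
    module H = Graph H

  data VertexView : H.Vertex → Set where
    oldᵛ    : ∀ w → VertexView (oldV w)
    cornerᵛ : ∀ i → VertexView (corner i)

  data EdgeView : H.Edge → Set where
    oldᵉ  : ∀ d → EdgeView (oldE d)
    sideᵉ : ∀ j → EdgeView (side j)

  vertexView : ∀ u → VertexView u
  vertexView u with Inverse.from vertices u | Inverse.strictlyInverseˡ vertices u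
  ... | inj₁ w | refl = oldᵛ w
  ... | inj₂ i | refl = cornerᵛ i

  edgeView : ∀ d → EdgeView d
  edgeView d with Inverse.from edges d | Inverse.strictlyInverseˡ edges d
  ... | inj₁ d′ | refl = oldᵉ d′
  ... | inj₂ j  | refl = sideᵉ j

  to-edges-injective : Injective _≡_ _≡_ (Inverse.to edges)
  to-edges-injective {a} {b} eq = trans (sym (Inverse.strictlyInverseʳ edges a))
    (trans (cong (Inverse.from edges) eq) (Inverse.strictlyInverseʳ edges b))

  oldE≢side : ∀ {d j} → oldE d ≢ side j
  oldE≢side eq with () ← to-edges-injective eq

  contract : H.Vertex → G.Vertex
  contract = [ proj₁ , const v ]′ ∘ Inverse.from vertices

  contract-oldV : ∀ w → contract (oldV w) ≡ proj₁ w
  contract-oldV w = cong [ proj₁ , const v ]′ (Inverse.strictlyInverseʳ vertices (inj₁ w))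

  contract-corner : ∀ i → contract (corner i) ≡ v
  contract-corner i = cong [ proj₁ , const v ]′ (Inverse.strictlyInverseʳ vertices (inj₂ i))

  oldV-unique : ∀ {w w′} → proj₁ w ≡ proj₁ w′ → oldV w ≡ oldV w′
  oldV-unique {_ , _} {_ , _} refl = refl

  contract-Incident : ∀ u d → H.Incident u (oldE d) → G.Incident (contract u) d
  contract-Incident u d inc with vertexView u
  ... | oldᵛ w rewrite contract-oldV w = Equivalence.to (oldV-oldE w d) inc
  ... | cornerᵛ i rewrite contract-corner i =
    Equivalence.from (e-incident d) (i , Equivalence.to (corner-oldE i d) inc)

  lift-Incident : ∀ u d → G.Incident u d → ∃[ u′ ] contract u′ ≡ u × H.Incident u′ (oldE d)
  lift-Incident u d inc with u ≟ v
  ... | no u≢v = oldV (u , u≢v) , contract-oldV _ , Equivalence.from (oldV-oldE (u , u≢v) d) inc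
  ... | yes refl with i , refl ← Equivalence.to (e-incident d) inc =
    corner i , contract-corner i , Equivalence.from (corner-oldE i (e i)) refl

  outer : VertexEdgeSets G → Fin 3 → Bool
  outer C = lookup (E C) ∘ e

  sides : VertexEdgeSets H → Fin 3 → Bool
  sides D = lookup (E D) ∘ side

  -- A corner counts as visited when one of its two sides is used: degree two cannot be reached by
  -- its outer edge alone.
  lift : VertexEdgeSets G → (Fin 3 → Bool) → VertexEdgeSets H
  lift C σ = ⟨ tabulate ([ lookup (V C) ∘ proj₁ , (λ i → σ (next i) ∨ σ (next (next i))) ]′ ∘ Inverse.from vertices)
             , tabulate ([ lookup (E C) , σ ]′ ∘ Inverse.from edges) ⟩

  -- The centre has no bit of its own in `H`, so it is read off the outer edges. The decision is an
  -- argument so that later lemmas can split on any proof of it.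
  contracted : VertexEdgeSets H → ∀ u → Dec (u ≡ v) → Bool
  contracted D u (yes _)  = some (lookup (E D) ∘ oldE ∘ e)
  contracted D u (no u≢v) = lookup (V D) (oldV (u , u≢v))

  project : VertexEdgeSets H → VertexEdgeSets G
  project D = ⟨ tabulate (λ u → contracted D u (u ≟ v)) , tabulate (lookup (E D) ∘ oldE) ⟩

  module _ (C : VertexEdgeSets G) (σ : Fin 3 → Bool) where

    lift-oldV : ∀ w → lookup (V (lift C σ)) (oldV w) ≡ lookup (V C) (proj₁ w)
    lift-oldV w = trans (lookup∘tabulate _ (oldV w))
      (cong [ _ , _ ]′ (Inverse.strictlyInverseʳ vertices (inj₁ w)))

    lift-corner : ∀ i → lookup (V (lift C σ)) (corner i) ≡ σ (next i) ∨ σ (next (next i))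
    lift-corner i = trans (lookup∘tabulate _ (corner i))
      (cong [ _ , _ ]′ (Inverse.strictlyInverseʳ vertices (inj₂ i)))

    lift-oldE : ∀ d → lookup (E (lift C σ)) (oldE d) ≡ lookup (E C) d
    lift-oldE d = trans (lookup∘tabulate _ (oldE d))
      (cong [ _ , _ ]′ (Inverse.strictlyInverseʳ edges (inj₁ d)))

    lift-side : ∀ j → lookup (E (lift C σ)) (side j) ≡ σ j
    lift-side j = trans (lookup∘tabulate _ (side j))
      (cong [ _ , _ ]′ (Inverse.strictlyInverseʳ edges (inj₂ j)))

  module _ (D : VertexEdgeSets H) where

    project-E : ∀ d → lookup (E (project D)) d ≡ lookup (E D) (oldE d)
    project-E d = lookup∘tabulate _ d

    project-v : lookup (V (project D)) v ≡ some (outer (project D))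
    project-v rewrite project-E (e 0F) | project-E (e 1F) | project-E (e 2F) =
      trans (lookup∘tabulate _ v) (at (v ≟ v))
      where
      at : ∀ v≟v → contracted D v v≟v ≡ some (lookup (E D) ∘ oldE ∘ e)
      at (yes _)  = refl
      at (no v≢v) = contradiction refl v≢v

    project-V : ∀ w → lookup (V (project D)) (proj₁ w) ≡ lookup (V D) (oldV w)
    project-V (u , u≢v) = trans (lookup∘tabulate _ u) (at (u ≟ v))
      where
      at : ∀ u≟v → contracted D u u≟v ≡ lookup (V D) (oldV (u , u≢v))
      at (yes u≡v) = contradiction u≡v u≢v
      at (no _)    = refl

  sets-ext : ∀ {D D′} →
             (∀ w → lookup (V D) (oldV w) ≡ lookup (V D′) (oldV w)) →
             (∀ i → lookup (V D) (corner i) ≡ lookup (V D′) (corner i)) →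
             (∀ d → lookup (E D) (oldE d) ≡ lookup (E D′) (oldE d)) →
             (∀ j → sides D j ≡ sides D′ j) → D ≡ D′
  sets-ext {D} {D′} eqV eqC eqE eqS = cong₂ ⟨_,_⟩ (lookup-ext _ _ onV) (lookup-ext _ _ onE)
    where
    onV : ∀ u → lookup (V D) u ≡ lookup (V D′) u
    onV u with vertexView u
    ... | oldᵛ w    = eqV w
    ... | cornerᵛ i = eqC i
    onE : ∀ d → lookup (E D) d ≡ lookup (E D′) d
    onE d with edgeView d
    ... | oldᵉ d′ = eqE d′
    ... | sideᵉ j = eqS j

  lift-cong : ∀ C {σ τ} → (∀ i → σ i ≡ τ i) → lift C σ ≡ lift C τ
  lift-cong C {σ} {τ} σ≗τ = sets-ext
    (λ w → trans (lift-oldV C σ w) (sym (lift-oldV C τ w)))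
    (λ i → trans (lift-corner C σ i) (trans (cong₂ _∨_ (σ≗τ _) (σ≗τ _)) (sym (lift-corner C τ i))))
    (λ d → trans (lift-oldE C σ d) (sym (lift-oldE C τ d)))
    (λ j → trans (lift-side C σ j) (trans (σ≗τ j) (sym (lift-side C τ j))))

  -- The order agrees with `Fits`, so that parity at corner `i` is the equation of `Fits` at `i`.
  atCorner : Fin 3 → Fin 3 → H.Edge
  atCorner i 0F = oldE (e i)
  atCorner i 1F = side (next i)
  atCorner i 2F = side (next (next i))

  atCorner-injective : ∀ i → Injective _≡_ _≡_ (atCorner i)
  atCorner-injective i {0F} {0F} _  = refl
  atCorner-injective i {0F} {1F} eq = contradiction eq oldE≢side
  atCorner-injective i {0F} {2F} eq = contradiction eq oldE≢side
  atCorner-injective i {1F} {0F} eq = contradiction (sym eq) oldE≢side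
  atCorner-injective i {1F} {1F} _  = refl
  atCorner-injective i {1F} {2F} eq =
    contradiction (sym (inj₂-injective (to-edges-injective eq))) (next≢ (next i))
  atCorner-injective i {2F} {0F} eq = contradiction (sym eq) oldE≢side
  atCorner-injective i {2F} {1F} eq =
    contradiction (inj₂-injective (to-edges-injective eq)) (next≢ (next i))
  atCorner-injective i {2F} {2F} _  = refl

  atCorner-Incident : ∀ i d → H.Incident (corner i) d ⇔ (∃[ k ] atCorner i k ≡ d)
  atCorner-Incident i d = mk⇔ to from
    where
    to : H.Incident (corner i) d → ∃[ k ] atCorner i k ≡ d
    to inc with edgeView d
    ... | oldᵉ d′ = 0F , cong oldE (Equivalence.to (corner-oldE i d′) inc)
    ... | sideᵉ j with ≢⇒next i j (Equivalence.to (corner-side i j) inc)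
    ...   | inj₁ refl = 1F , refl
    ...   | inj₂ refl = 2F , refl
    from : ∃[ k ] atCorner i k ≡ d → H.Incident (corner i) d
    from (0F , refl) = Equivalence.from (corner-oldE i (e i)) refl
    from (1F , refl) = Equivalence.from (corner-side i _) (next≢ i ∘ sym)
    from (2F , refl) = Equivalence.from (corner-side i _) (next²≢ i ∘ sym)

  module AtCorner i = Cubic {H} (corner i) (atCorner i) (atCorner-injective i) (atCorner-Incident i)
  module AtCentre = Cubic {G} v e e-injective e-incident

  outer⇒visited : ∀ {C} → IsTwoRegular {G} C → ∃[ i ] outer C i ≡ true → lookup (V C) v ≡ true
  outer⇒visited t (i , e∈) = IsTwoRegular.subgraph t e∈ (Equivalence.from (e-incident (e i)) (i , refl))

  degree-oldV : ∀ (C : VertexEdgeSets G) (D : VertexEdgeSets H) →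
                (∀ d → lookup (E D) (oldE d) ≡ lookup (E C) d) → ∀ w →
                ∣ E D ∩ H.δ (oldV w) ∣ ≡ ∣ E C ∩ G.δ (proj₁ w) ∣
  degree-oldV C D eq w = trans
    (∣p∣-preimage oldE (inj₁-injective ∘ to-edges-injective) (E D ∩ H.δ (oldV w)) onto)
    (cong ∣_∣ (lookup-ext (tabulate (lookup (E D ∩ H.δ (oldV w)) ∘ oldE)) (E C ∩ G.δ (proj₁ w)) λ d → begin
      lookup (tabulate (lookup (E D ∩ H.δ (oldV w)) ∘ oldE)) d ≡⟨ lookup∘tabulate _ d ⟩
      lookup (E D ∩ H.δ (oldV w)) (oldE d)                     ≡⟨ lookup-δ {H} (E D) (oldV w) (oldE d) ⟩
      lookup (E D) (oldE d) ∧ does (H.incident? (oldV w) (oldE d))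
        ≡⟨ cong₂ _∧_ (eq d) (does-⇔ (oldV-oldE w d) (H.incident? _ _) (G.incident? _ _)) ⟩
      lookup (E C) d ∧ does (G.incident? (proj₁ w) d)          ≡⟨ sym (lookup-δ {G} (E C) (proj₁ w) d) ⟩
      lookup (E C ∩ G.δ (proj₁ w)) d                           ∎))
    where
    open ≡-Reasoning
    onto : ∀ {d} → lookup (E D ∩ H.δ (oldV w)) d ≡ true → ∃[ d′ ] oldE d′ ≡ d
    onto {d} d∈ with edgeView d
    ... | oldᵉ d′ = d′ , refl
    ... | sideᵉ j = contradiction (lookup-δ⇒Incident {H} (E D) (oldV w) (side j) d∈) (oldV-side w j)

  module _ {C : VertexEdgeSets G} (t : IsTwoRegular C) {σ : Fin 3 → Bool} (fits : Fits (outer C) σ) where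
    open IsTwoRegular t
    private D = lift C σ

    lift-twoRegular : IsTwoRegular D
    lift-twoRegular = record { subgraph = λ {u} {d} → sub u d ; degree = λ {u} → deg u }
      where
      sub : ∀ u d → lookup (E D) d ≡ true → H.Incident u d → lookup (V D) u ≡ true
      sub u d d∈ inc with vertexView u | edgeView d
      ... | oldᵛ w | oldᵉ d′ = trans (lift-oldV C σ w)
        (subgraph (trans (sym (lift-oldE C σ d′)) d∈) (Equivalence.to (oldV-oldE w d′) inc))
      ... | oldᵛ w | sideᵉ j = contradiction inc (oldV-side w j)
      ... | cornerᵛ i | oldᵉ d′ with refl ← Equivalence.to (corner-oldE i d′) inc =
        trans (lift-corner C σ i) (xor⇒∨ {σ (next i)} (trans (sym (fits i)) (trans (sym (lift-oldE C σ (e i))) d∈)))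
        where
        xor⇒∨ : ∀ {a b} → a xor b ≡ true → a ∨ b ≡ true
        xor⇒∨ {true}         _ = refl
        xor⇒∨ {false} {true} _ = refl
      ... | cornerᵛ i | sideᵉ j with ≢⇒next i j (Equivalence.to (corner-side i j) inc)
      ...   | inj₁ refl = trans (lift-corner C σ i) (⊎⇒∨ (inj₁ (trans (sym (lift-side C σ j)) d∈)))
      ...   | inj₂ refl = trans (lift-corner C σ i)
        (⊎⇒∨ {σ (next i)} (inj₂ (trans (sym (lift-side C σ j)) d∈)))
      deg : ∀ u → lookup (V D) u ≡ true → ∣ E D ∩ H.δ u ∣ ≡ 2
      deg u u∈ with vertexView u
      ... | oldᵛ w = trans (degree-oldV C (lift C σ) (lift-oldE C σ) w) (degree (trans (sym (lift-oldV C σ w)) u∈))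
      ... | cornerᵛ i rewrite AtCorner.degree≡ i (E D)
                     | lift-oldE C σ (e i) | lift-side C σ (next i) | lift-side C σ (next (next i)) =
        ∣abc∣≡2⇐ (outer C i) (σ (next i)) (σ (next (next i))) (fits i) (trans (sym (lift-corner C σ i)) u∈)

  module _ (D : VertexEdgeSets H) where
    hop : ∀ {i j k} → i ≢ k → j ≢ k → sides D k ≡ true → Star (Step H D) (corner i) (corner j)
    hop {i} {j} {k} i≢k j≢k σk =
      (side k , lookup⇒[]= _ _ σk , Equivalence.from (corner-side i k) i≢k , Equivalence.from (corner-side j k) j≢k) ◅ ε

    corners-connected : ∀ {i j a b} → i ≢ a → sides D a ≡ true → j ≢ b → sides D b ≡ true →
                        Star (Step H D) (corner i) (corner j)
    corners-connected {i} {j} {a} {b} i≢a σa j≢b σb with j ≟ a | i ≟ b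
    ... | no j≢a | _ = hop i≢a j≢a σa
    ... | yes _ | no i≢b = hop i≢b j≢b σb
    -- Here `a` is opposite to `j` and `b` is opposite to `i`, so the third corner lies on both
    -- sides.
    ... | yes refl | yes refl with k , k≢i , k≢j ← third i j = hop i≢a k≢j σa ◅◅ hop k≢i j≢b σb

  corner⇒side : ∀ C σ i → lookup (V (lift C σ)) (corner i) ≡ true →
                ∃[ j ] i ≢ j × sides (lift C σ) j ≡ true
  corner⇒side C σ i i∈ with ∨-true {σ (next i)} (trans (sym (lift-corner C σ i)) i∈)
  ... | inj₁ eq = next i , next≢ i ∘ sym , trans (lift-side C σ _) eq
  ... | inj₂ eq = next (next i) , next²≢ i ∘ sym , trans (lift-side C σ _) eq

  -- Only the fibre over `v` has several vertices. A visited corner lies on a used side, and any two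
  -- sides of the triangle share a corner.
  fibre-connected : ∀ C σ {x y} → lookup (V (lift C σ)) x ≡ true → lookup (V (lift C σ)) y ≡ true →
                    contract x ≡ contract y → Star (Step H (lift C σ)) x y
  fibre-connected C σ {x} {y} x∈ y∈ eq with vertexView x | vertexView y
  ... | oldᵛ w | oldᵛ w′ = subst (Star _ (oldV w))
    (oldV-unique (trans (sym (contract-oldV w)) (trans eq (contract-oldV w′)))) ε
  ... | oldᵛ w | cornerᵛ i =
    contradiction (trans (sym (contract-oldV w)) (trans eq (contract-corner i))) (proj₂ w)
  ... | cornerᵛ i | oldᵛ w =
    contradiction (trans (sym (contract-oldV w)) (trans (sym eq) (contract-corner i))) (proj₂ w)
  ... | cornerᵛ i | cornerᵛ j
    with a , i≢a , σa ← corner⇒side C σ i x∈ | b , j≢b , σb ← corner⇒side C σ j y∈ =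
    corners-connected (lift C σ) i≢a σa j≢b σb

  -- Each edge of the path in `G` is kept as an old edge; where consecutive ones end at different
  -- corners, a path inside the fibre joins them.
  lift-connected : ∀ C σ → IsTwoRegular (lift C σ) → ∀ {u u′} → Star (Step G C) u u′ → ∀ {x y} →
                   lookup (V (lift C σ)) x ≡ true → lookup (V (lift C σ)) y ≡ true →
                   contract x ≡ u → contract y ≡ u′ → Star (Step H (lift C σ)) x y
  lift-connected C σ t ε x∈ y∈ eqx eqy = fibre-connected C σ x∈ y∈ (trans eqx (sym eqy))
  lift-connected C σ t ((d , d∈ , inc , inc′) ◅ path) x∈ y∈ eqx eqy
    with x₀ , eqx₀ , incx₀ ← lift-Incident _ d inc | x₁ , eqx₁ , incx₁ ← lift-Incident _ d inc′ =
    fibre-connected C σ x∈ (subgraph d∈D incx₀) (trans eqx (sym eqx₀)) ◅◅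
    ((oldE d , lookup⇒[]= _ _ d∈D , incx₀ , incx₁) ◅
     lift-connected C σ t path (subgraph d∈D incx₁) y∈ eqx₁ eqy)
    where
    open IsTwoRegular t
    d∈D : lookup (E (lift C σ)) (oldE d) ≡ true
    d∈D = trans (lift-oldE C σ d) ([]=⇒lookup d∈)

  -- `NotAll` ensures that used sides lead to an outer edge, so a visited corner lies over a vertex
  -- of `C`; otherwise the triangle could form a component of its own.
  lift-circuit : ∀ {C σ} → IsCircuit G C → Fits (outer C) σ → NotAll σ → IsCircuit H (lift C σ)
  lift-circuit {C} {σ} c fits notAll = mkCircuit t nonempty λ {x} {y} x∈ y∈ →
    lift-connected C σ t (IsCircuit.connected c (lookup⇒[]= _ _ (down x x∈)) (lookup⇒[]= _ _ (down y y∈)))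
      x∈ y∈ refl refl
    where
    t : IsTwoRegular (lift C σ)
    t = lift-twoRegular (circuit⇒twoRegular c) fits
    open IsTwoRegular t
    down : ∀ x → lookup (V (lift C σ)) x ≡ true → lookup (V C) (contract x) ≡ true
    down x x∈ with vertexView x
    ... | oldᵛ w rewrite contract-oldV w = trans (sym (lift-oldV C σ w)) x∈
    ... | cornerᵛ i rewrite contract-corner i with ∨-true {σ (next i)} (trans (sym (lift-corner C σ i)) x∈)
    ...   | inj₁ eq = outer⇒visited (circuit⇒twoRegular c) (fits-exits fits notAll _ eq)
    ...   | inj₂ eq = outer⇒visited (circuit⇒twoRegular c) (fits-exits fits notAll _ eq)
    nonempty : ∃[ x ] lookup (V (lift C σ)) x ≡ true
    nonempty with u , u∈ ← IsCircuit.nonempty c with u ≟ v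
    ... | no u≢v = oldV (u , u≢v) , trans (lift-oldV C σ _) ([]=⇒lookup u∈)
    ... | yes refl with ∨-true {outer C 1F} (trans (sym (AtCentre.visited (circuit⇒twoRegular c))) ([]=⇒lookup u∈))
    ...   | inj₁ e∈ = corner 1F , subgraph (trans (lift-oldE C σ _) e∈) (Equivalence.from (corner-oldE _ _) refl)
    ...   | inj₂ e∈ = corner 2F , subgraph (trans (lift-oldE C σ _) e∈) (Equivalence.from (corner-oldE _ _) refl)

  outer-even : ∀ {C} → IsTwoRegular C → outer C 0F ≡ outer C 1F xor outer C 2F
  outer-even t = AtCentre.parity t

  sides-fit : ∀ {D} → IsTwoRegular D → Fits (outer (project D)) (sides D)
  sides-fit {D} t i = trans (project-E D (e i)) (AtCorner.parity i t)

  -- The projection forgets the sides and the bits of the corners; two-regularity recovers the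
  -- latter from the former.
  lift-project : ∀ {D} → IsTwoRegular D → lift (project D) (sides D) ≡ D
  lift-project {D} t = sets-ext
    (λ w → trans (lift-oldV (project D) (sides D) w) (project-V D w))
    (λ i → trans (lift-corner (project D) (sides D) i) (sym (AtCorner.visited i t)))
    (λ d → trans (lift-oldE (project D) (sides D) d) (project-E D d))
    (lift-side (project D) (sides D))

  project-lift : ∀ {C} → IsTwoRegular C → ∀ σ → project (lift C σ) ≡ C
  project-lift {C} t σ = cong₂ ⟨_,_⟩ (lookup-ext _ _ onV) (lookup-ext _ _ onE)
    where
    onE : ∀ d → lookup (E (project (lift C σ))) d ≡ lookup (E C) d
    onE d = trans (project-E (lift C σ) d) (lift-oldE C σ d)
    onV : ∀ u → lookup (V (project (lift C σ))) u ≡ lookup (V C) u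
    onV u with u ≟ v
    ... | no u≢v  = trans (project-V (lift C σ) (u , u≢v)) (lift-oldV C σ (u , u≢v))
    ... | yes refl = begin
      lookup (V (project (lift C σ))) v ≡⟨ project-v (lift C σ) ⟩
      some (outer (project (lift C σ))) ≡⟨ cong₂ _∨_ (onE (e 0F)) (cong₂ _∨_ (onE (e 1F)) (onE (e 2F))) ⟩
      some (outer C)                    ≡⟨ some-even (outer C) (outer-even t) ⟩
      outer C 1F ∨ outer C 2F           ≡⟨ sym (AtCentre.visited t) ⟩
      lookup (V C) v                    ∎
      where open ≡-Reasoning

  module _ {D : VertexEdgeSets H} (t : IsTwoRegular D) where
    open IsTwoRegular t
    private C = project D

    project-twoRegular : IsTwoRegular (project D)
    project-twoRegular = record { subgraph = λ {u} {d} → sub u d ; degree = λ {u} → deg u }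
      where
      sub : ∀ u d → lookup (E C) d ≡ true → G.Incident u d → lookup (V C) u ≡ true
      sub u d d∈ inc with u ≟ v
      ... | no u≢v = trans (project-V D (u , u≢v))
        (subgraph (trans (sym (project-E D d)) d∈) (Equivalence.from (oldV-oldE (u , u≢v) d) inc))
      ... | yes refl with i , refl ← Equivalence.to (e-incident d) inc =
        trans (project-v D) (some⁺ (outer C) i d∈)
      deg : ∀ u → lookup (V C) u ≡ true → ∣ E C ∩ G.δ u ∣ ≡ 2
      deg u u∈ with u ≟ v
      ... | no u≢v = trans (sym (degree-oldV C D (sym ∘ project-E D) (u , u≢v)))
        (degree (trans (sym (project-V D (u , u≢v))) u∈))
      ... | yes refl = trans (AtCentre.degree≡ (E C))
        (∣abc∣≡2⇐ (outer C 0F) (outer C 1F) (outer C 2F) even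
          (trans (sym (some-even (outer C) even)) (trans (sym (project-v D)) u∈)))
        where even = fits⇒even {outer C} {sides D} (sides-fit t)

    -- Steps along a side stay in the fibre over `v` and are dropped; all other steps use old edges.
    project-path : ∀ {x y} → Star (Step H D) x y → Star (Step G C) (contract x) (contract y)
    project-path ε = ε
    project-path {x} (_◅_ {j = z} (d , d∈ , incx , incz) path) with edgeView d
    ... | oldᵉ d′ = (d′ , lookup⇒[]= _ _ (trans (project-E D d′) ([]=⇒lookup d∈))
                        , contract-Incident x d′ incx , contract-Incident z d′ incz) ◅ project-path path
    ... | sideᵉ j = subst (λ u → Star (Step G C) u _)
      (trans (at-v z incz) (sym (at-v x incx))) (project-path path)
      where
      at-v : ∀ x → H.Incident x (side j) → contract x ≡ v
      at-v x inc with vertexView x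
      ... | oldᵛ w    = contradiction inc (oldV-side w j)
      ... | cornerᵛ i = contract-corner i

  -- `NotAll` excludes the triangle, whose projection is empty: a circuit that visits a corner then
  -- uses an outer edge and so leaves a trace at `v`.
  project-circuit : ∀ {D} → IsCircuit H D → NotAll (sides D) → IsCircuit G (project D)
  project-circuit {D} c notAll = mkCircuit (project-twoRegular t) nonempty connected
    where
    C = project D
    t : IsTwoRegular D
    t = circuit⇒twoRegular c
    nonempty : ∃[ u ] lookup (V C) u ≡ true
    nonempty with x , x∈ ← IsCircuit.nonempty c with vertexView x
    ... | oldᵛ w = proj₁ w , trans (project-V D w) ([]=⇒lookup x∈)
    ... | cornerᵛ i = v , outer⇒visited (project-twoRegular t) exit
      where
      exit : ∃[ i ] outer C i ≡ true
      exit with ∨-true {sides D (next i)} (trans (sym (AtCorner.visited i t)) ([]=⇒lookup x∈))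
      ... | inj₁ eq = fits-exits {outer C} {sides D} (sides-fit t) notAll _ eq
      ... | inj₂ eq = fits-exits {outer C} {sides D} (sides-fit t) notAll _ eq
    above : ∀ u → lookup (V C) u ≡ true → ∃[ x ] lookup (V D) x ≡ true × contract x ≡ u
    above u u∈ with u ≟ v
    ... | no u≢v = oldV (u , u≢v) , trans (sym (project-V D (u , u≢v))) u∈ , contract-oldV (u , u≢v)
    ... | yes refl with i , ei∈ ← some⁻ (outer C) (trans (sym (project-v D)) u∈) =
      corner i , IsTwoRegular.subgraph t (trans (sym (project-E D (e i))) ei∈)
                   (Equivalence.from (corner-oldE i (e i)) refl)
               , contract-corner i
    connected : ∀ {u w} → lookup (V C) u ≡ true → lookup (V C) w ≡ true → Star (Step G C) u w
    connected u∈ w∈ with x , x∈ , refl ← above _ u∈ | y , y∈ , refl ← above _ w∈ =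
      project-path t (IsCircuit.connected c (lookup⇒[]= _ _ x∈) (lookup⇒[]= _ _ y∈))

  private
    -- Not a circuit, but two-regular, so that the triangle is a lift as well.
    ∅ : VertexEdgeSets G
    ∅ = ⟨ ⊥ , ⊥ ⟩

    ∅V : ∀ u → lookup (V ∅) u ≡ false
    ∅V u = lookup-replicate u false

    ∅E : ∀ d → lookup (E ∅) d ≡ false
    ∅E d = lookup-replicate d false

    ∅-twoRegular : IsTwoRegular ∅
    ∅-twoRegular = record
      { subgraph = λ {_} {d} d∈ _ → contradiction (trans (sym d∈) (∅E d)) true≢false
      ; degree   = λ {u} u∈ → contradiction (trans (sym u∈) (∅V u)) true≢false
      }

  triangle : VertexEdgeSets H
  triangle = lift ∅ (const true)

  triangle-oldE : ∀ d → lookup (E triangle) (oldE d) ≡ false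
  triangle-oldE d = trans (lift-oldE ∅ (const true) d) (∅E d)

  triangle-side : ∀ j → sides triangle j ≡ true
  triangle-side = lift-side ∅ (const true)

  triangle-circuit : IsCircuit H triangle
  triangle-circuit = mkCircuit (lift-twoRegular ∅-twoRegular (∅E ∘ e)) (corner 0F , lift-corner ∅ (const true) 0F)
    λ {x} {y} x∈ y∈ → fibre-connected ∅ (const true) x∈ y∈ (trans (at-v x x∈) (sym (at-v y y∈)))
    where
    at-v : ∀ x → lookup (V triangle) x ≡ true → contract x ≡ v
    at-v x x∈ with vertexView x
    ... | oldᵛ w    = contradiction (trans (sym x∈) (trans (lift-oldV ∅ (const true) w) (∅V (proj₁ w)))) true≢false
    ... | cornerᵛ i = contract-corner i

  -- The sides alone give every corner degree two, so no outer edge is used. A walk starting at a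
  -- corner then never leaves the corners, and connectedness excludes everything else.
  sides⇒triangle : ∀ {D} → IsCircuit H D → (∀ j → sides D j ≡ true) → D ≡ triangle
  sides⇒triangle {D} c all = sets-ext
    (λ w → trans (¬-not (no-oldV w)) (sym (trans (lift-oldV ∅ (const true) w) (∅V (proj₁ w)))))
    (λ i → trans (corner∈ i) (sym (lift-corner ∅ (const true) i)))
    (λ d → trans (¬-not (no-oldE d)) (sym (triangle-oldE d)))
    (λ j → trans (all j) (sym (triangle-side j)))
    where
    t : IsTwoRegular D
    t = circuit⇒twoRegular c
    no-exit : ∀ i → lookup (E D) (oldE (e i)) ≢ true
    no-exit i ei∈ = true≢false (trans (sym ei∈) (trans (AtCorner.parity i t)
      (cong₂ _xor_ (all (next i)) (all (next (next i))))))
    corner∈ : ∀ i → lookup (V D) (corner i) ≡ true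
    corner∈ i = trans (AtCorner.visited i t) (cong₂ _∨_ (all (next i)) (all (next (next i))))
    stay : ∀ {i x} → Star (Step H D) (corner i) x → ∃[ j ] corner j ≡ x
    stay {i} ε = i , refl
    stay {i} (_◅_ {j = z} (d , d∈ , inc , incz) path) with edgeView d
    ... | oldᵉ d′ with refl ← Equivalence.to (corner-oldE i d′) inc =
      contradiction ([]=⇒lookup d∈) (no-exit i)
    ... | sideᵉ j with vertexView z
    ...   | oldᵛ w    = contradiction incz (oldV-side w j)
    ...   | cornerᵛ k = stay path
    no-oldV : ∀ w → lookup (V D) (oldV w) ≢ true
    no-oldV w w∈ with i , eq ← stay (IsCircuit.connected c (lookup⇒[]= _ _ (corner∈ 0F)) (lookup⇒[]= _ _ w∈)) =
      proj₂ w (trans (sym (contract-oldV w)) (trans (cong contract (sym eq)) (contract-corner i)))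
    no-oldE : ∀ d → lookup (E D) (oldE d) ≢ true
    no-oldE d d∈ with x ← proj₁ (H.ends (oldE d)) in eqx
      with x∈ ← IsTwoRegular.subgraph t d∈ (inj₁ (sym eqx)) with vertexView x
    ... | oldᵛ w = no-oldV w x∈
    ... | cornerᵛ i with refl ← Equivalence.to (corner-oldE i d) (inj₁ (sym eqx)) = no-exit i d∈

-- The two lifts of a double cover

open CircuitDoubleCover

module _ {G : Graph} where
  open VertexEdgeSets

  covers-twice : ∀ (M : CircuitDoubleCover G) d → count (λ C → lookup (E C) d) (members M) ≡ 2
  covers-twice M d = trans (sym (count-covers (members M) d)) (covers M d)

  mkCover : ∀ N → All (IsCircuit G) N → (∀ d → count (λ C → lookup (E C) d) N ≡ 2) → CircuitDoubleCover G
  mkCover N circ twice = record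
    { members = N ; circuits = circ ; covers = λ d → trans (count-covers N d) (twice d) }

  twoRegulars : ∀ (M : CircuitDoubleCover G) → All IsTwoRegular (members M)
  twoRegulars M = All.map circuit⇒twoRegular (circuits M)

module Doubling {G H : Graph} {v : Graph.Vertex G} (X : IsExpansion G v H) where
  open IsExpansion X
  open VertexEdgeSets
  open Expansion X
  private
    module G = Graph G
    module H = Graph H

  short long : VertexEdgeSets G → VertexEdgeSets H
  short C = lift C (shortcut (outer C))
  long  C = lift C (outer C)

  short-circuit : ∀ {C} → IsCircuit G C → IsCircuit H (short C)
  short-circuit {C} c = lift-circuit c (fits-shortcut (outer C) even) (notAll-shortcut (outer C) even)
    where even = outer-even (circuit⇒twoRegular c)

  long-circuit : ∀ {C} → IsCircuit G C → IsCircuit H (long C)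
  long-circuit {C} c = lift-circuit c (fits-self (outer C) even) (notAll-self (outer C) even)
    where even = outer-even (circuit⇒twoRegular c)

  count-lift : ∀ (σ : VertexEdgeSets G → Fin 3 → Bool) M {f g} →
               (∀ C → f (lift C (σ C)) ≡ g C) → count f (map (λ C → lift C (σ C)) M) ≡ count g M
  count-lift σ M {f} {g} eq = trans (total-map (bit ∘ f) _ M)
    (count-cong (All.universal eq M))

  -- A short lift uses side `j` when its circuit contains both outer edges other than `e j`, which
  -- happens for exactly one member; the triangle supplies the second occurrence. A long lift uses
  -- side `j` exactly when its circuit uses `e j`, so the long lifts suffice.
  double : Fin 2 → CircuitDoubleCover G → CircuitDoubleCover H
  double 0F M = mkCover (triangle ∷ map short (members M))
    (triangle-circuit ∷ All.map⁺ (All.map short-circuit (circuits M))) twice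
    where
    N = triangle ∷ map short (members M)
    twice : ∀ d → count (λ D → lookup (E D) d) N ≡ 2
    twice d with edgeView d
    ... | oldᵉ d′ = cong₂ _+_ (cong bit (triangle-oldE d′))
      (trans (count-lift _ (members M) (λ C → lift-oldE C _ d′)) (covers-twice M d′))
    ... | sideᵉ j = cong₂ _+_ (cong bit (triangle-side j))
      (trans (count-lift _ (members M) (λ C → lift-side C _ j))
        (count-transition (All.map (λ {C} t → fits-self (outer C) (outer-even t) j) (twoRegulars M))
          (covers-twice M _) (covers-twice M _) (covers-twice M _)))
  double 1F M = mkCover (map long (members M)) (All.map⁺ (All.map long-circuit (circuits M))) twice
    where
    twice : ∀ d → count (λ D → lookup (E D) d) (map long (members M)) ≡ 2
    twice d with edgeView d
    ... | oldᵉ d′ = trans (count-lift _ (members M) (λ C → lift-oldE C _ d′)) (covers-twice M d′)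
    ... | sideᵉ j = trans (count-lift _ (members M) (λ C → lift-side C _ j)) (covers-twice M (e j))

  double-cong : ∀ b {M M′} → members M ↭ members M′ → members (double b M) ↭ members (double b M′)
  double-cong 0F p = prep triangle (map⁺ short p)
  double-cong 1F p = map⁺ long p

  unlift : ∀ (σ : VertexEdgeSets G → Fin 3 → Bool) M M′ →
           map (λ C → lift C (σ C)) (members M) ↭ map (λ C → lift C (σ C)) (members M′) →
           members M ↭ members M′
  unlift σ M M′ p = subst₂ _↭_ (back M) (back M′) (map⁺ project p)
    where
    back : ∀ M → map project (map (λ C → lift C (σ C)) (members M)) ≡ members M
    back M = trans (sym (map-∘ (members M)))
      (map-id-local (All.map (λ {C} t → project-lift t (σ C)) (twoRegulars M)))

  -- Every long lift misses a side, whereas the triangle has them all.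
  short≁long : ∀ M M′ → ¬ (members (double 0F M) ↭ members (double 1F M′))
  short≁long M M′ p with All-resp-↭ {P = NotAll ∘ sides} (↭-sym p) (All.map⁺ (All.map notAll (twoRegulars M′)))
    where
    notAll : ∀ {C} → IsTwoRegular C → NotAll (sides (long C))
    notAll {C} t with i , eq ← notAll-self (outer C) (outer-even t) = i , trans (lift-side C _ i) eq
  ... | (i , eq) ∷ _ = contradiction (trans (sym (triangle-side i)) eq) true≢false

  double-injective : ∀ b b′ M M′ → members (double b M) ↭ members (double b′ M′) →
                     b ≡ b′ × members M ↭ members M′
  double-injective 0F 0F M M′ p = refl , unlift _ M M′ (drop-∷ p)
  double-injective 1F 1F M M′ p = refl , unlift _ M M′ p
  double-injective 0F 1F M M′ p = contradiction p (short≁long M M′)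
  double-injective 1F 0F M M′ p = contradiction (↭-sym p) (short≁long M′ M)

  module _ (N : CircuitDoubleCover H) where

    project-cover : ∀ {Ds} → All (IsCircuit H) Ds → All (NotAll ∘ sides) Ds →
                    (∀ d → count (λ D → lookup (E D) (oldE d)) Ds ≡ 2) → CircuitDoubleCover G
    project-cover {Ds} circ notAll twice = mkCover (map project Ds)
      (All.map⁺ (All.zipWith (λ (c , n) → project-circuit c n) (circ , notAll)))
      λ d → trans (total-map _ project Ds)
        (trans (count-cong (All.universal (λ D → project-E D d) Ds)) (twice d))

    count-pair : ∀ i → count (λ D → shortcut (sides D) i) (members N) ≡ 1
    count-pair i = count-transition (All.map (λ t → AtCorner.parity i t) (twoRegulars N))
      (covers-twice N _) (covers-twice N _) (covers-twice N _)

    relift : ∀ (σ : VertexEdgeSets G → Fin 3 → Bool) {Ds} → All (IsCircuit H) Ds →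
             All (λ D → ∀ i → sides D i ≡ σ (project D) i) Ds →
             map (λ C → lift C (σ C)) (map project Ds) ≡ Ds
    relift σ {Ds} circ eqs = trans (sym (map-∘ Ds)) (map-id-local (All.zipWith
      (λ {D} (c , eq) → trans (lift-cong (project D) (sym ∘ eq)) (lift-project (circuit⇒twoRegular c)))
      (circ , eqs)))

    -- At each corner the triangle is already the one member that uses both sides, so `only-short`
    -- applies to all the others.
    with-triangle : ∀ {Ds} → members N ↭ triangle ∷ Ds → ∃₂ λ b M → members (double b M) ↭ members N
    with-triangle {Ds} p = 0F , project-cover circ (All.map (λ {D} → notAll {D}) pairs) twice
      , ↭-trans (↭-reflexive (cong (triangle ∷_) (relift (shortcut ∘ outer) circ
          (All.zipWith (λ {D} (c , eqs) → only-short (sides-fit (circuit⇒twoRegular c)) eqs) (circ , pairs)))))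
        (↭-sym p)
      where
      circ : All (IsCircuit H) Ds
      circ = All.tail (All-resp-↭ p (circuits N))
      twice : ∀ d → count (λ D → lookup (E D) (oldE d)) Ds ≡ 2
      twice d = trans (sym (cong (_+ count (λ D → lookup (E D) (oldE d)) Ds) (cong bit (triangle-oldE d))))
        (trans (sym (total-↭ (λ D → bit (lookup (E D) (oldE d))) p)) (covers-twice N (oldE d)))
      pair : ∀ i → All (λ D → shortcut (sides D) i ≡ false) Ds
      pair i = count≡0 Ds (ℕ.suc-injective (trans
        (sym (cong (_+ count (λ D → shortcut (sides D) i) Ds)
          (cong bit (cong₂ _∧_ (triangle-side (next i)) (triangle-side (next (next i)))))))
        (trans (sym (total-↭ (λ D → bit (shortcut (sides D) i)) p)) (count-pair i))))
      pairs : All (λ D → ∀ i → shortcut (sides D) i ≡ false) Ds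
      pairs = All.zipWith (λ (p₀ , p₁ , p₂) → λ { 0F → p₀ ; 1F → p₁ ; 2F → p₂ })
        (pair 0F , All.zip (pair 1F , pair 2F))
      notAll : ∀ {D} → (∀ i → shortcut (sides D) i ≡ false) → NotAll (sides D)
      notAll {D} eqs with sides D 1F in eq
      ... | false = 1F , eq
      ... | true  = 2F , trans (sym (cong (_∧ sides D 2F) eq)) (eqs 0F)

    without-triangle : All (λ D → every (sides D) ≡ false) (members N) →
                       ∃₂ λ b M → members (double b M) ↭ members N
    without-triangle ¬every = 1F
      , project-cover (circuits N) (All.map (λ {D} → ¬every⇒NotAll (sides D)) ¬every) (covers-twice N ∘ oldE)
      , ↭-reflexive (relift outer (circuits N)
          (All.zipWith (λ {D} (t , ¬e , eqs) → only-long (sides-fit t) ¬e eqs)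
            (twoRegulars N , All.zip (¬every , singles))))
      where
      ¬every₁ : All (λ D → sides D 1F ∧ (sides D 2F ∧ sides D 0F) ≡ false) (members N)
      ¬every₁ = All.map (λ {D} → trans (sym (∧-rotate (sides D 0F) (sides D 1F) (sides D 2F)))) ¬every
      ¬every₂ : All (λ D → sides D 2F ∧ (sides D 0F ∧ sides D 1F) ≡ false) (members N)
      ¬every₂ = All.map (λ {D} → trans (sym (∧-rotate (sides D 1F) (sides D 2F) (sides D 0F)))) ¬every₁
      no-single : ∀ i → All (λ D → single (sides D) i ≡ false) (members N)
      -- Pairs of sides are indexed by the corner where they meet: sides `0F` and `1F` at `2F`,
      -- sides `2F` and `0F` at `1F`.
      no-single 0F = count≡0 _ (count-single ¬every (covers-twice N _) (count-pair 2F) (count-pair 1F))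
      no-single 1F = count≡0 _ (count-single ¬every₁ (covers-twice N _) (count-pair 0F) (count-pair 2F))
      no-single 2F = count≡0 _ (count-single ¬every₂ (covers-twice N _) (count-pair 1F) (count-pair 0F))
      singles : All (λ D → ∀ i → single (sides D) i ≡ false) (members N)
      singles = All.zipWith (λ (p₀ , p₁ , p₂) → λ { 0F → p₀ ; 1F → p₁ ; 2F → p₂ })
        (no-single 0F , All.zip (no-single 1F , no-single 2F))

    double-surjective : ∃₂ λ b M → members (double b M) ↭ members N
    double-surjective with count (λ D → every (sides D)) (members N) in eq
    ... | zero  = without-triangle (count≡0 (members N) eq)
    ... | suc _ with D , Ds , p , all ← extract (λ D → every (sides D)) (members N) eq =
      with-triangle (subst (λ T → members N ↭ T ∷ Ds)
        (sides⇒triangle (All.head (All-resp-↭ p (circuits N))) (every⁻ (sides D) all)) p)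

-- Doubling the number of covers and counting vertices

Numbering : Graph → ℕ → Set
Numbering G k = Bijection (setoid (Fin k)) (circuitDoubleCovers G)

module _ {G H : Graph} {v : Graph.Vertex G} (X : IsExpansion G v H) where
  open Doubling X

  double-numbering : ∀ {k} → Numbering G k → Numbering H (2 * k)
  double-numbering {k} φ = record
    { to        = to
    ; cong      = λ { refl → ↭-refl }
    ; bijective = (λ {x} {y} → injective x y) , surjective
    }
    where
    module φ = Bijection φ
    to : Fin (2 * k) → CircuitDoubleCover H
    to x = let b , i = remQuot {2} k x in double b (φ.to i)
    injective : ∀ x y → members (to x) ↭ members (to y) → x ≡ y
    injective x y p
      with b≡b′ , q ← double-injective (proj₁ (remQuot {2} k x)) (proj₁ (remQuot {2} k y)) _ _ p =
      trans (sym (combine-remQuot {2} k x))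
        (trans (cong₂ combine b≡b′ (φ.injective q)) (combine-remQuot {2} k y))
    to-combine : ∀ b i → to (combine b i) ≡ double b (φ.to i)
    to-combine b i = cong (λ (b , i) → double b (φ.to i)) (remQuot-combine b i)
    surjective : ∀ N → ∃[ x ] (∀ {z} → z ≡ x → members (to z) ↭ members N)
    surjective N with b , M , p ← double-surjective N with i , q ← φ.surjective M =
      combine b i , λ { refl → ↭-trans (↭-reflexive (cong members (to-combine b i)))
        (↭-trans (double-cong b {φ.to i} {M} (q refl)) p) }

punctured↔ : ∀ {n} (v : Fin (suc n)) → Fin n ↔ (∃[ w ] w ≢ v)
punctured↔ v = mk↔ₛ′ (λ i → punchIn v i , punchInᵢ≢i v i) (λ (w , w≢v) → punchOut (w≢v ∘ sym))
  (λ (w , w≢v) → ext (punchIn-punchOut (w≢v ∘ sym)))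
  (λ i → trans (punchOut-cong v refl) (punchOut-punchIn v))
  where
  ext : ∀ {a b : ∃[ w ] w ≢ v} → proj₁ a ≡ proj₁ b → a ≡ b
  ext {_ , _} {_ , _} refl = refl

expansion-#V : ∀ {G v H} → IsExpansion G v H → Graph.#V H ≡ 2 + Graph.#V G
expansion-#V {G} {v} {H} X = go (Graph.#V G) v (IsExpansion.vertices X)
  where
  -- The vertex count becomes a variable so that it can be matched; `v` itself rules out zero.
  go : ∀ n (v : Fin n) → ((∃[ w ] w ≢ v) ⊎ Fin 3) ↔ Graph.Vertex H → Graph.#V H ≡ 2 + n
  go (suc n) v vertices = trans (sym (↔⇒≡ (vertices ↔-∘ ((punctured↔ v ⊎-↔ ↔-id (Fin 3)) ↔-∘ +↔⊎))))
    (+-comm n 3)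

-- The unique double cover of the triple edge

module Theta (ends : Fin 3 → Fin 2 × Fin 2) (loopless : ∀ d → proj₁ (ends d) ≢ proj₂ (ends d)) where
  open VertexEdgeSets

  G : Graph
  G = record { #V = 2 ; #E = 3 ; ends = ends ; loopless = loopless }

  open Graph G using (Incident)

  module _ (joined : ∀ v d → Incident v d) where

    module At v = Cubic {G} v id id (λ d → mk⇔ (λ _ → d , refl) (λ _ → joined v d))

    digon : Fin 3 → VertexEdgeSets G
    digon k = ⟨ replicate 2 true , tabulate (λ d → not (does (d ≟ k))) ⟩

    digon-circuit : ∀ k → IsCircuit G (digon k)
    digon-circuit k = mkCircuit
      (record { subgraph = λ {v} _ _ → lookup-replicate v true
              ; degree   = λ {v} _ → trans (At.degree≡ v (E (digon k))) (degree k) })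
      (0F , refl)
      λ {u} {w} _ _ → let d , d∈ = edge k in (d , lookup⇒[]= d _ d∈ , joined u d , joined w d) ◅ ε
      where
      degree : ∀ k → ∣ tabulate (lookup (E (digon k))) ∣ ≡ 2
      degree 0F = refl
      degree 1F = refl
      degree 2F = refl
      edge : ∀ k → ∃[ d ] lookup (E (digon k)) d ≡ true
      edge 0F = 1F , refl
      edge 1F = 0F , refl
      edge 2F = 0F , refl

    module _ {C : VertexEdgeSets G} (c : IsCircuit G C) where
      private
        x : Fin 3 → Bool
        x = lookup (E C)

        t : IsTwoRegular C
        t = circuit⇒twoRegular c

      even : x 0F ≡ x 1F xor x 2F
      even = At.parity 0F t

      visited : ∀ u → lookup (V C) u ≡ some x
      visited u = trans (At.visited u t) (sym (some-even x even))

      nonempty-E : some x ≡ true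
      nonempty-E with u , u∈ ← IsCircuit.nonempty c = trans (sym (visited u)) ([]=⇒lookup u∈)

      -- With the two edges other than `k` in use, parity excludes `k`, and both vertices are
      -- visited.
      digon-unique : ∀ k → shortcut x k ≡ true → C ≡ digon k
      digon-unique k pair = cong₂ ⟨_,_⟩
        (lookup-ext _ _ λ u → trans (visited u) (trans nonempty-E (sym (lookup-replicate u true))))
        (lookup-ext _ _ λ j → trans (edges k pair j) (sym (lookup∘tabulate (λ d → not (does (d ≟ k))) j)))
        where
        both : ∀ {a b} → a ∧ b ≡ true → a ≡ true × b ≡ true
        both {true} eq = refl , eq
        edges : ∀ k → shortcut x k ≡ true → ∀ j → x j ≡ not (does (j ≟ k))
        edges k pair j with a , b ← both {x (next k)} pair with j ≟ k
        ... | yes refl = trans (fits-self x even k) (cong₂ _xor_ a b)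
        ... | no j≢k with ≢⇒next k j (j≢k ∘ sym)
        ...   | inj₁ refl = a
        ...   | inj₂ refl = b

    theta-cover : CircuitDoubleCover G
    theta-cover = mkCover (digon 0F ∷ digon 1F ∷ digon 2F ∷ [])
      (digon-circuit 0F ∷ digon-circuit 1F ∷ digon-circuit 2F ∷ [])
      λ { 0F → refl ; 1F → refl ; 2F → refl }

    extract-digon : ∀ k {N} → All (IsCircuit G) N → count (λ C → shortcut (lookup (E C)) k) N ≡ 1 →
                    ∃[ N′ ] N ↭ digon k ∷ N′
    extract-digon k {N} circ eq with C , N′ , p , pair ← extract (λ C → shortcut (lookup (E C)) k) N eq =
      N′ , subst (λ C → N ↭ C ∷ N′) (digon-unique (All.head (All-resp-↭ p circ)) k pair) p

    module _ (M : CircuitDoubleCover G) where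
      private
        pair : ∀ k → count (λ C → shortcut (lookup (E C)) k) (members M) ≡ 1
        pair k = count-transition (All.map (λ {C} c → fits-self (lookup (E C)) (even c) k) (circuits M))
          (covers-twice M _) (covers-twice M _) (covers-twice M _)

        -- The three digons already cover each edge twice, so a further member would have no edges,
        -- which no circuit here allows.
        no-more : ∀ R → members M ↭ digon 0F ∷ digon 1F ∷ digon 2F ∷ R → R ≡ []
        no-more []      _ = refl
        no-more (C ∷ R) p with c ∷ _ ← All.tail (All.tail (All.tail (All-resp-↭ p (circuits M))))
          with d , d∈ ← some⁻ (lookup (E C)) (nonempty-E c) =
          contradiction (trans (sym d∈) (All.head (absent d))) true≢false
          where
          absent : ∀ d → All (λ C → lookup (E C) d ≡ false) (C ∷ R)
          absent d = count≡0 (C ∷ R) (remaining d (trans (sym (total-↭ _ p)) (covers-twice M d)))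
            where
            remaining : ∀ d → count (λ C → lookup (E C) d) (digon 0F ∷ digon 1F ∷ digon 2F ∷ C ∷ R) ≡ 2 →
                        count (λ C → lookup (E C) d) (C ∷ R) ≡ 0
            remaining 0F eq = ℕ.suc-injective (ℕ.suc-injective eq)
            remaining 1F eq = ℕ.suc-injective (ℕ.suc-injective eq)
            remaining 2F eq = ℕ.suc-injective (ℕ.suc-injective eq)

      theta-cover-unique : members M ↭ members theta-cover
      theta-cover-unique
        with N₁ , p₁ ← extract-digon 0F (circuits M) (pair 0F)
        with circ₁ ← All.tail (All-resp-↭ p₁ (circuits M))
        -- `digon 0F` lacks the edge `0F`, hence does not contain the pair opposite to `1F`;
        -- removing it leaves that count unchanged.
        with N₂ , p₂ ← extract-digon 1F circ₁ (trans (sym (total-↭ _ p₁)) (pair 1F))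
        with circ₂ ← All.tail (All-resp-↭ p₂ circ₁)
        with R , p₃ ← extract-digon 2F circ₂ (trans (sym (trans (total-↭ _ p₁) (total-↭ _ p₂))) (pair 2F))
        with p ← ↭-trans p₁ (prep _ (↭-trans p₂ (prep _ p₃))) =
        subst (λ R → members M ↭ digon 0F ∷ digon 1F ∷ digon 2F ∷ R) (no-more R p) p

    theta-numbering : Numbering G 1
    theta-numbering = record
      { to        = const theta-cover
      ; cong      = λ _ → ↭-refl
      ; bijective = (λ { {0F} {0F} _ → refl }) , λ M → 0F , λ _ → ↭-sym (theta-cover-unique M)
      }

-- Induction on the number of expansions

numbering : ∀ {G} → ExpandedTripleEdge G → ∃[ k ] Graph.#V G ≡ suc k * 2 × Numbering G (2 ^ k)
-- Matching both size equations with `refl` turns vertices and edges into `Fin 2` and `Fin 3`, the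
-- form in which `Theta` computes.
numbering (start {record { ends = ends ; loopless = loopless }}
                 record { two-vertices = refl ; three-edges = refl ; joined = joined }) =
  0 , refl , Theta.theta-numbering ends loopless joined
numbering (expand G′ v X) with k , #V , φ ← numbering G′ =
  suc k , trans (expansion-#V X) (cong (2 +_) #V) , double-numbering X φ

corollary28 : (G : Graph) → ExpandedTripleEdge G →
    Bijection (setoid (Fin (2 ^ (Graph.#V G / 2 ∸ 1)))) (circuitDoubleCovers G)
corollary28 G expanded with k , #V , φ ← numbering expanded =
  -- The number of vertices is `suc k * 2`, where `k` counts the expansions, so halving and
  -- subtracting one leaves `k`.
  subst (λ n → Numbering G (2 ^ n))
    (sym (trans (cong (λ n → n / 2 ∸ 1) #V) (cong (_∸ 1) (m*n/n≡m (suc k) 2)))) φ
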